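{- The reduction $\triangleright$ is confluent on fair terms: for every fair term $t$, if $t\triangleright^* t_1$ and $t\triangleright^* t_2$, then there is a term $t_3$ with $t_1\triangleright^* t_3$ and $t_2\triangleright^* t_3$.
   Context: Atoms are the variables (from an infinite set) and the constants $S_0,S_1,S_2,S_3,K_0,K_1,I_0,I_1$. Terms: $T::= \alpha \mid (T\ T)$ for atoms $\alpha$; application associates to the left. For $i\in\{0,1\}$, a variable $x$ and a term $t$, the set of terms $\lambda_i x.t$ is defined by: if $t=x$, $\lambda_i x.t=\{I_i\}$; if $t\neq x$ is an atom, $\lambda_i x.t=\{(K_i\ t)\}$; if $t=(u\ v)$ and $x$ does not occur in $t$, $\lambda_i x.t=\{(K_i\ t)\}\cup\{(S_{i+2}\ u'\ v') : u'\in\lambda_i x.u,\ v'\in\lambda_i x.v\}$; if $t=(u\ v)$ and $x$ occurs in $t$, $\lambda_i x.t=\{(S_{i+2}\ u'\ v') : u'\in\lambda_i x.u,\ v'\in\lambda_i x.v\}$. The reduction $\triangleright$ on terms is the closure under application contexts of: $(S_i\ u\ v\ w)\triangleright(u\ w\ (v\ w))$ for $i=1,3$; $(K_1\ u\ v)\triangleright u$; $(I_1\ u)\triangleright u$; $(S_{i+2}\ (K_i\ u)\ (K_i\ v))\triangleright(K_i\ (u\ v))$ for $i=0,1$; and, for $i=0,1$: if $u\triangleright v$, $t\in\lambda_i x.u$ and $t'\in\lambda_i x.v$ then $t\triangleright t'$. $\triangleright^*$ is its reflexive–transitive closure. An address is a finite list over $\{l,r\}$; $u_a$ is the subterm of $u$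 at address $a$ ($u_\varepsilon=u$, $(u\ v)_{l::a}=u_a$, $(u\ v)_{r::a}=v_a$), and $a<a'$ means $a$ is an initial segment of $a'$. A pair $(u,f)$, with $f$ a function from a set of addresses of $u$ into terms, is adequate if there are no $a,a'\in\mathrm{dom}(f)$ with $a<a'$. For adequate $(u,f)$ and a variable $x$, $\phi_x(u,f)$ denotes any term obtained from $u$ by replacing, for each $a\in\mathrm{dom}(f)$, the subterm at address $a$ by $(w_a\ f(a))$ for some $w_a\in\lambda_1 x.u_a$. The set $F$ of fair terms is the smallest set such that: every variable, $S_0$, $K_0$, $I_0$ are fair; if $u,v$ are fair so is $(u\ v)$; if $u$ is fair and $t\in\lambda_0 x.u$ then $t$ is fair; if $v_1,v_2,v_3$ are fair then so are $(S_1\ v_1\ v_2\ v_3)$, $(K_1\ v_1\ v_2)$, $(I_1\ v_1)$; if $x$ is a variable, $u$ is fair, every term in the image of $f$ is fair and $(u,f)$ is adequate, then $\phi_x(u,f)$ is fair. -}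

module Defs where

open import Data.Nat using (ℕ)
open import Data.List using (List; []; _∷_)
open import Data.Maybe using (Maybe; just; nothing)
open import Data.Product using (_×_)
open import Relation.Nullary using (¬_)
open import Relation.Binary.PropositionalEquality using (_≡_; _≢_)
open import Relation.Binary.Construct.Closure.ReflexiveTransitive using (Star)

data Const : Set where
  S₀ S₁ S₂ S₃ K₀ K₁ I₀ I₁ : Const

data Term : Set where
  var : ℕ → Term
  con : Const → Term
  _·_ : Term → Term → Term

infixl 7 _·_

data Lvl : Set where
  ₀ ₁ : Lvl

Kc : Lvl → Term
Kc ₀ = con K₀
Kc ₁ = con K₁

Ic : Lvl → Term
Ic ₀ = con I₀
Ic ₁ = con I₁

Sc : Lvl → Term
Sc ₀ = con S₂
Sc ₁ = con S₃

data Occurs (x : ℕ) : Term → Set where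
  occ-here : Occurs x (var x)
  occ-l    : ∀ {u v} → Occurs x u → Occurs x (u · v)
  occ-r    : ∀ {u v} → Occurs x v → Occurs x (u · v)

-- Lam i x t t'  means  t' ∈ λᵢ x.t
data Lam (i : Lvl) (x : ℕ) : Term → Term → Set where
  lam-I     : Lam i x (var x) (Ic i)
  lam-Kvar  : ∀ {y} → y ≢ x → Lam i x (var y) (Kc i · var y)
  lam-Kcon  : ∀ {c} → Lam i x (con c) (Kc i · con c)
  lam-Kapp  : ∀ {u v} → ¬ Occurs x (u · v) → Lam i x (u · v) (Kc i · (u · v))
  lam-S     : ∀ {u v u′ v′} → Lam i x u u′ → Lam i x v v′ →
              Lam i x (u · v) (Sc i · u′ · v′)

infix 4 _▷_ _▷*_
data _▷_ : Term → Term → Set where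
  red-S₁  : ∀ {u v w} → con S₁ · u · v · w ▷ u · w · (v · w)
  red-S₃  : ∀ {u v w} → con S₃ · u · v · w ▷ u · w · (v · w)
  red-K₁  : ∀ {u v} → con K₁ · u · v ▷ u
  red-I₁  : ∀ {u} → con I₁ · u ▷ u
  red-SK  : ∀ (i : Lvl) {u v} → Sc i · (Kc i · u) · (Kc i · v) ▷ Kc i · (u · v)
  red-lam : ∀ (i : Lvl) (x : ℕ) {u v t t′} → u ▷ v → Lam i x u t → Lam i x v t′ → t ▷ t′
  red-appl : ∀ {u u′ v} → u ▷ u′ → u · v ▷ u′ · v
  red-appr : ∀ {u v v′} → v ▷ v′ → u · v ▷ u · v′

_▷*_ : Term → Term → Set
_▷*_ = Star _▷_

data Dir : Set where
  l r : Dir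

Addr : Set
Addr = List Dir

sub : Term → Addr → Maybe Term
sub u [] = just u
sub (u · v) (l ∷ a) = sub u a
sub (u · v) (r ∷ a) = sub v a
sub (var _) (_ ∷ _) = nothing
sub (con _) (_ ∷ _) = nothing

data _<ᵃ_ : Addr → Addr → Set where
  pre-[] : ∀ {d a} → [] <ᵃ (d ∷ a)
  pre-∷  : ∀ {d a a′} → a <ᵃ a′ → (d ∷ a) <ᵃ (d ∷ a′)

PMap : Set
PMap = Addr → Maybe Term

DomOf : Term → PMap → Set
DomOf u f = ∀ a s → f a ≡ just s → sub u a ≢ nothing

Adequate : Term → PMap → Set
Adequate u f = DomOf u f × (∀ a a′ s s′ → f a ≡ just s → f a′ ≡ just s′ → ¬ (a <ᵃ a′))

data IsAtom : Term → Set where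
  atom-var : ∀ {y} → IsAtom (var y)
  atom-con : ∀ {c} → IsAtom (con c)

-- Phi x u f t  means  t is one of the terms φₓ(u,f): for each a ∈ dom f the
-- subterm at a is replaced by (wₐ f(a)) for some wₐ ∈ λ₁ x.uₐ.
data Phi (x : ℕ) : Term → PMap → Term → Set where
  phi-here : ∀ {u f s w} → f [] ≡ just s → Lam ₁ x u w → Phi x u f (w · s)
  phi-atom : ∀ {u f} → f [] ≡ nothing → IsAtom u → Phi x u f u
  phi-app  : ∀ {u v f u′ v′} → f [] ≡ nothing →
             Phi x u (λ a → f (l ∷ a)) u′ → Phi x v (λ a → f (r ∷ a)) v′ →
             Phi x (u · v) f (u′ · v′)

data Fair : Term → Set where
  fair-var : ∀ {y} → Fair (var y)
  fair-S₀  : Fair (con S₀)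
  fair-K₀  : Fair (con K₀)
  fair-I₀  : Fair (con I₀)
  fair-app : ∀ {u v} → Fair u → Fair v → Fair (u · v)
  fair-lam : ∀ {x u t} → Fair u → Lam ₀ x u t → Fair t
  fair-S₁  : ∀ {v₁ v₂ v₃} → Fair v₁ → Fair v₂ → Fair v₃ → Fair (con S₁ · v₁ · v₂ · v₃)
  fair-K₁  : ∀ {v₁ v₂} → Fair v₁ → Fair v₂ → Fair (con K₁ · v₁ · v₂)
  fair-I₁  : ∀ {v₁} → Fair v₁ → Fair (con I₁ · v₁)
  fair-phi : ∀ {x u t} (f : PMap) → Fair u → (∀ a s → f a ≡ just s → Fair s) →
             Adequate u f → Phi x u f t → Fair t

{-# OPTIONS --safe #-}
-- Fair terms are simply typed: every variable has base type o, λ₁ builds functions o ⇒ τ,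
-- λ₀ builds elements of an inert type □ τ, and □ o may be read as o.  A deterministic
-- evaluation, which opens a λ₀ with the variable k at level k and closes it again with the
-- K-preferring abstraction, computes normal forms.  Reducibility as a partial equivalence
-- relation whose base case is "same value at every level" shows that a term and its reducts
-- evaluate to the same normal form; once k bounds the variables, evaluation is itself a
-- sequence of reductions.
module Submission where

open import Defs
open import Data.Empty using (⊥-elim)
open import Data.Nat using (ℕ; zero; suc; _<_; _≤_; _⊔_)
open import Data.Nat.Properties
  using (_≟_; <-irrefl; ≤-trans; n≤1+n; n<1+n; ≤∧≢⇒<; ≤-pred; m≤m⊔n; m≤n⊔m)
open import Data.Maybe using (just)
open import Data.List using ([]; _∷_)
open import Data.Product using (Σ; ∃; _×_; _,_; proj₁; proj₂)
open import Data.Unit using (⊤; tt)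
open import Function using (_∘_)
open import Relation.Nullary using (¬_; Dec; yes; no; contradiction)
open import Relation.Binary.PropositionalEquality
  using (_≡_; _≢_; refl; sym; cong; cong₂; subst; subst₂)
open import Relation.Binary.Construct.Closure.ReflexiveTransitive
  using (ε; _◅_; _◅◅_; gmap)

-- Simple types for combinator terms

infixr 6 _⇒_
data Ty : Set where
  o   : Ty
  _⇒_ : Ty → Ty → Ty
  □_  : Ty → Ty

-- Functional application and inert application at `o` share one relation, because abstracting
-- either kind yields the same `S₂` or `S₃` term.
data Ap : Ty → Ty → Ty → Set where
  fun   : ∀ {σ τ} → Ap (σ ⇒ τ) σ τ
  inert : Ap o o o

-- Reading □ o as o needs no subtyping rule: it is enough that K₀, I₀ and S₂ have a second type.
infix 4 _∶_
data _∶_ : Term → Ty → Set where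
  ⊢var : ∀ {x} → var x ∶ o
  ⊢S₀  : con S₀ ∶ o
  ⊢K₀  : con K₀ ∶ o
  ⊢I₀  : con I₀ ∶ o
  ⊢K□  : ∀ {τ} → con K₀ ∶ τ ⇒ □ τ
  ⊢I□  : con I₀ ∶ □ o
  ⊢S□  : ∀ {ρ σ τ} → Ap ρ σ τ → con S₂ ∶ □ ρ ⇒ □ σ ⇒ □ τ
  ⊢S₂  : ∀ {ρ σ} → Ap ρ σ o → con S₂ ∶ □ ρ ⇒ □ σ ⇒ o
  ⊢K₁  : ∀ {τ} → con K₁ ∶ τ ⇒ o ⇒ τ
  ⊢I₁  : con I₁ ∶ o ⇒ o
  ⊢S₁  : con S₁ ∶ o ⇒ o ⇒ o ⇒ o
  ⊢S₃  : ∀ {ρ σ τ} → Ap ρ σ τ → con S₃ ∶ (o ⇒ ρ) ⇒ (o ⇒ σ) ⇒ o ⇒ τ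
  ⊢app : ∀ {ρ σ τ u v} → Ap ρ σ τ → u ∶ ρ → v ∶ σ → u · v ∶ τ

Arr : Lvl → Ty → Ty
Arr ₀ τ = □ τ
Arr ₁ τ = o ⇒ τ

-- Abstractions, and the typing of fair terms

-- The shapes of the terms in λᵢ x. u, with the instance operation undoing the abstraction.
data Abs : Set where
  κ : Term → Abs
  ι : Abs
  ς : Abs → Abs → Abs

⌜_⌝ : Abs → Lvl → Term
⌜ κ u ⌝ i = Kc i · u
⌜ ι ⌝ i = Ic i
⌜ ς A B ⌝ i = Sc i · ⌜ A ⌝ i · ⌜ B ⌝ i

_[_] : Abs → Term → Term
κ u [ s ] = u
ι [ s ] = s
ς A B [ s ] = A [ s ] · B [ s ]

FreshA : ℕ → Abs → Set
FreshA x (κ u) = ¬ Occurs x u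
FreshA x ι = ⊤
FreshA x (ς A B) = FreshA x A × FreshA x B

-- Indexing by one shape `A` lets a match expose the body and its abstraction at once. Freshness
-- ensures that `x` occurs in the body only at the `ι` leaves.
data Abstracts (i : Lvl) (x : ℕ) : Term → Term → Set where
  abstracts : ∀ A → FreshA x A → Abstracts i x (A [ var x ]) (⌜ A ⌝ i)

Lam⇒Abstracts : ∀ {i x u t} → Lam i x u t → Abstracts i x u t
Lam⇒Abstracts lam-I = abstracts ι tt
Lam⇒Abstracts (lam-Kvar y≢x) = abstracts (κ _) λ { occ-here → y≢x refl }
Lam⇒Abstracts lam-Kcon = abstracts (κ _) λ ()
Lam⇒Abstracts (lam-Kapp x∉) = abstracts (κ _) x∉
Lam⇒Abstracts (lam-S p q) with Lam⇒Abstracts p | Lam⇒Abstracts q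
... | abstracts A x∉A | abstracts B x∉B = abstracts (ς A B) (x∉A , x∉B)

Abs⇒Lam : ∀ i {x} A → FreshA x A → Lam i x (A [ var x ]) (⌜ A ⌝ i)
Abs⇒Lam i (κ (var y)) x∉ = lam-Kvar λ { refl → x∉ occ-here }
Abs⇒Lam i (κ (con c)) x∉ = lam-Kcon
Abs⇒Lam i (κ (u · v)) x∉ = lam-Kapp x∉
Abs⇒Lam i ι x∉ = lam-I
Abs⇒Lam i (ς A B) (x∉A , x∉B) = lam-S (Abs⇒Lam i A x∉A) (Abs⇒Lam i B x∉B)

infix 4 _∶ᵇ_
data _∶ᵇ_ : Abs → Ty → Set where
  ⊢κ : ∀ {u τ} → u ∶ τ → κ u ∶ᵇ τ
  ⊢ι : ι ∶ᵇ o
  ⊢ς : ∀ {A B ρ σ τ} → Ap ρ σ τ → A ∶ᵇ ρ → B ∶ᵇ σ → ς A B ∶ᵇ τ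

⊢inst : ∀ {A s τ} → A ∶ᵇ τ → s ∶ o → A [ s ] ∶ τ
⊢inst (⊢κ ⊢u) ⊢s = ⊢u
⊢inst ⊢ι ⊢s = ⊢s
⊢inst (⊢ς ap ⊢A ⊢B) ⊢s = ⊢app ap (⊢inst ⊢A ⊢s) (⊢inst ⊢B ⊢s)

-- A variable has only the type `o`, which is the type that an `ι` leaf requires.
⊢uninst : ∀ {x τ} A → A [ var x ] ∶ τ → A ∶ᵇ τ
⊢uninst (κ u) ⊢u = ⊢κ ⊢u
⊢uninst ι ⊢var = ⊢ι
⊢uninst (ς A B) (⊢app ap ⊢A ⊢B) = ⊢ς ap (⊢uninst A ⊢A) (⊢uninst B ⊢B)

-- `base` is confined to level `₀`: it lets the λ₀-abstraction of a fair term have type `o` again.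
data AbsTy : Lvl → Abs → Ty → Set where
  arrow : ∀ {i A τ} → A ∶ᵇ τ → AbsTy i A (Arr i τ)
  base  : ∀ {A} → A ∶ᵇ o → AbsTy ₀ A o

⊢Abs : ∀ i {A τ} → A ∶ᵇ τ → ⌜ A ⌝ i ∶ Arr i τ
⊢Abs ₀ (⊢κ ⊢u) = ⊢app fun ⊢K□ ⊢u
⊢Abs ₁ (⊢κ ⊢u) = ⊢app fun ⊢K₁ ⊢u
⊢Abs ₀ ⊢ι = ⊢I□
⊢Abs ₁ ⊢ι = ⊢I₁
⊢Abs ₀ (⊢ς ap ⊢A ⊢B) = ⊢app fun (⊢app fun (⊢S□ ap) (⊢Abs ₀ ⊢A)) (⊢Abs ₀ ⊢B)
⊢Abs ₁ (⊢ς ap ⊢A ⊢B) = ⊢app fun (⊢app fun (⊢S₃ ap) (⊢Abs ₁ ⊢A)) (⊢Abs ₁ ⊢B)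

AbsTy⇒⊢ : ∀ {i A τ} → AbsTy i A τ → ⌜ A ⌝ i ∶ τ
AbsTy⇒⊢ (arrow ⊢A) = ⊢Abs _ ⊢A
AbsTy⇒⊢ (base (⊢κ ⊢u)) = ⊢app inert ⊢K₀ ⊢u
AbsTy⇒⊢ (base ⊢ι) = ⊢I₀
AbsTy⇒⊢ (base (⊢ς ap ⊢A ⊢B)) = ⊢app fun (⊢app fun (⊢S₂ ap) (⊢Abs ₀ ⊢A)) (⊢Abs ₀ ⊢B)

⊢⇒AbsTy : ∀ i A {τ} → ⌜ A ⌝ i ∶ τ → AbsTy i A τ
⊢Abs⁻¹ : ∀ i A {τ} → ⌜ A ⌝ i ∶ Arr i τ → A ∶ᵇ τ

⊢⇒AbsTy ₀ (κ u) (⊢app fun ⊢K□ ⊢u) = arrow (⊢κ ⊢u)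
⊢⇒AbsTy ₀ (κ u) (⊢app inert ⊢K₀ ⊢u) = base (⊢κ ⊢u)
⊢⇒AbsTy ₁ (κ u) (⊢app fun ⊢K₁ ⊢u) = arrow (⊢κ ⊢u)
⊢⇒AbsTy ₀ ι ⊢I□ = arrow ⊢ι
⊢⇒AbsTy ₀ ι ⊢I₀ = base ⊢ι
⊢⇒AbsTy ₁ ι ⊢I₁ = arrow ⊢ι
⊢⇒AbsTy ₀ (ς A B) (⊢app fun (⊢app fun (⊢S□ ap) ⊢A) ⊢B) =
  arrow (⊢ς ap (⊢Abs⁻¹ ₀ A ⊢A) (⊢Abs⁻¹ ₀ B ⊢B))
⊢⇒AbsTy ₀ (ς A B) (⊢app fun (⊢app fun (⊢S₂ ap) ⊢A) ⊢B) =
  base (⊢ς ap (⊢Abs⁻¹ ₀ A ⊢A) (⊢Abs⁻¹ ₀ B ⊢B))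
⊢⇒AbsTy ₀ (ς A B) (⊢app inert (⊢app fun () _) _)
⊢⇒AbsTy ₁ (ς A B) (⊢app fun (⊢app fun (⊢S₃ ap) ⊢A) ⊢B) =
  arrow (⊢ς ap (⊢Abs⁻¹ ₁ A ⊢A) (⊢Abs⁻¹ ₁ B ⊢B))
⊢⇒AbsTy ₁ (ς A B) (⊢app inert (⊢app fun () _) _)

⊢Abs⁻¹ ₀ A ⊢A with ⊢⇒AbsTy ₀ A ⊢A
... | arrow ⊢A′ = ⊢A′
⊢Abs⁻¹ ₁ A ⊢A with ⊢⇒AbsTy ₁ A ⊢A
... | arrow ⊢A′ = ⊢A′

⊢Lam : ∀ {i x u t τ} → Lam i x u t → u ∶ τ → ∃ λ A → t ≡ ⌜ A ⌝ i × A ∶ᵇ τ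
⊢Lam p ⊢u with Lam⇒Abstracts p
... | abstracts A _ = A , refl , ⊢uninst A ⊢u

-- At a replaced address of type `σ`, the term `w` has type `o ⇒ σ` and its argument type `o`, so
-- the type found there is kept.
⊢Phi : ∀ {x u f t τ} → (∀ a s → f a ≡ just s → s ∶ o) → Phi x u f t → u ∶ τ → t ∶ τ
⊢Phi ⊢f (phi-here fε p) ⊢u with ⊢Lam p ⊢u
... | A , refl , ⊢A = ⊢app fun (⊢Abs ₁ ⊢A) (⊢f [] _ fε)
⊢Phi ⊢f (phi-atom _ _) ⊢u = ⊢u
⊢Phi ⊢f (phi-app _ p q) (⊢app ap ⊢u ⊢v) =
  ⊢app ap (⊢Phi (λ a → ⊢f (l ∷ a)) p ⊢u) (⊢Phi (λ a → ⊢f (r ∷ a)) q ⊢v)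

⊢Fair : ∀ {t} → Fair t → t ∶ o
⊢Fair fair-var = ⊢var
⊢Fair fair-S₀ = ⊢S₀
⊢Fair fair-K₀ = ⊢K₀
⊢Fair fair-I₀ = ⊢I₀
⊢Fair (fair-app p q) = ⊢app inert (⊢Fair p) (⊢Fair q)
⊢Fair (fair-lam p q) with ⊢Lam q (⊢Fair p)
... | A , refl , ⊢A = AbsTy⇒⊢ (base ⊢A)
⊢Fair (fair-S₁ p q s) = ⊢app fun (⊢app fun (⊢app fun ⊢S₁ (⊢Fair p)) (⊢Fair q)) (⊢Fair s)
⊢Fair (fair-K₁ p q) = ⊢app fun (⊢app fun ⊢K₁ (⊢Fair p)) (⊢Fair q)
⊢Fair (fair-I₁ p) = ⊢app fun ⊢I₁ (⊢Fair p)
⊢Fair (fair-phi f p q _ φ) = ⊢Phi (λ a s e → ⊢Fair (q a s e)) φ (⊢Fair p)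

-- Weak head reduction and subject reduction

infix 4 _⟶_
data _⟶_ : Term → Term → Set where
  S₁-step : ∀ {u v w} → con S₁ · u · v · w ⟶ u · w · (v · w)
  S₃-step : ∀ {u v w} → con S₃ · u · v · w ⟶ u · w · (v · w)
  K₁-step : ∀ {u v} → con K₁ · u · v ⟶ u
  I₁-step : ∀ {u} → con I₁ · u ⟶ u
  head    : ∀ {u u′ v} → u ⟶ u′ → u · v ⟶ u′ · v

⟶⇒▷ : ∀ {t t′} → t ⟶ t′ → t ▷ t′
⟶⇒▷ S₁-step = red-S₁
⟶⇒▷ S₃-step = red-S₃
⟶⇒▷ K₁-step = red-K₁
⟶⇒▷ I₁-step = red-I₁
⟶⇒▷ (head p) = red-appl (⟶⇒▷ p)

⟶-deterministic : ∀ {t t₁ t₂} → t ⟶ t₁ → t ⟶ t₂ → t₁ ≡ t₂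
⟶-deterministic S₁-step S₁-step = refl
⟶-deterministic S₁-step (head (head (head ())))
⟶-deterministic S₃-step S₃-step = refl
⟶-deterministic S₃-step (head (head (head ())))
⟶-deterministic K₁-step K₁-step = refl
⟶-deterministic K₁-step (head (head ()))
⟶-deterministic I₁-step I₁-step = refl
⟶-deterministic I₁-step (head ())
⟶-deterministic (head (head (head ()))) S₁-step
⟶-deterministic (head (head (head ()))) S₃-step
⟶-deterministic (head p) (head q) = cong (_· _) (⟶-deterministic p q)

⊢-⟶ : ∀ {t t′ τ} → t ⟶ t′ → t ∶ τ → t′ ∶ τ
⊢-⟶ S₁-step (⊢app fun (⊢app fun (⊢app fun ⊢S₁ ⊢u) ⊢v) ⊢w) =
  ⊢app inert (⊢app inert ⊢u ⊢w) (⊢app inert ⊢v ⊢w)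
⊢-⟶ S₁-step (⊢app inert (⊢app fun (⊢app fun () _) _) _)
⊢-⟶ S₃-step (⊢app fun (⊢app fun (⊢app fun (⊢S₃ ap) ⊢u) ⊢v) ⊢w) =
  ⊢app ap (⊢app fun ⊢u ⊢w) (⊢app fun ⊢v ⊢w)
⊢-⟶ S₃-step (⊢app inert (⊢app fun (⊢app fun () _) _) _)
⊢-⟶ K₁-step (⊢app fun (⊢app fun ⊢K₁ ⊢u) _) = ⊢u
⊢-⟶ K₁-step (⊢app inert (⊢app fun () _) _)
⊢-⟶ I₁-step (⊢app fun ⊢I₁ ⊢u) = ⊢u
⊢-⟶ (head p) (⊢app ap ⊢u ⊢v) = ⊢app ap (⊢-⟶ p ⊢u) ⊢v

AbsTy-map : ∀ {i A B} → (∀ {τ} → A ∶ᵇ τ → B ∶ᵇ τ) → ∀ {τ} → AbsTy i A τ → AbsTy i B τ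
AbsTy-map f (arrow ⊢A) = arrow (f ⊢A)
AbsTy-map f (base ⊢A) = base (f ⊢A)

⊢SK : ∀ {u v τ} → ς (κ u) (κ v) ∶ᵇ τ → κ (u · v) ∶ᵇ τ
⊢SK (⊢ς ap (⊢κ ⊢u) (⊢κ ⊢v)) = ⊢κ (⊢app ap ⊢u ⊢v)

⊢-▷ : ∀ {t t′ τ} → t ▷ t′ → t ∶ τ → t′ ∶ τ
⊢-▷ red-S₁ = ⊢-⟶ S₁-step
⊢-▷ red-S₃ = ⊢-⟶ S₃-step
⊢-▷ red-K₁ = ⊢-⟶ K₁-step
⊢-▷ red-I₁ = ⊢-⟶ I₁-step
⊢-▷ (red-SK i {u} {v}) = AbsTy⇒⊢ ∘ AbsTy-map ⊢SK ∘ ⊢⇒AbsTy i (ς (κ u) (κ v))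
⊢-▷ (red-lam i x p lu lv) with Lam⇒Abstracts lu | Lam⇒Abstracts lv
... | abstracts A _ | abstracts B _ =
  -- The typing is pulled back to the body, where the induction hypothesis applies, and is then
  -- rebuilt in the same form, `arrow` or `base`.
  AbsTy⇒⊢ ∘ AbsTy-map (λ ⊢A → ⊢uninst B (⊢-▷ p (⊢inst ⊢A ⊢var))) ∘ ⊢⇒AbsTy i A
⊢-▷ (red-appl p) (⊢app ap ⊢u ⊢v) = ⊢app ap (⊢-▷ p ⊢u) ⊢v
⊢-▷ (red-appr p) (⊢app ap ⊢u ⊢v) = ⊢app ap ⊢u (⊢-▷ p ⊢v)

-- Evaluation

occurs? : ∀ x t → Dec (Occurs x t)
occurs? x (var y) with x ≟ y
... | yes refl = yes occ-here
... | no x≢y = no λ { occ-here → x≢y refl }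
occurs? x (con c) = no λ ()
occurs? x (u · v) with occurs? x u | occurs? x v
... | yes p | _ = yes (occ-l p)
... | no _ | yes q = yes (occ-r q)
... | no ¬p | no ¬q = no λ { (occ-l p) → ¬p p ; (occ-r q) → ¬q q }

-- The element of λ₀ x. t that uses K₀ wherever possible.
λ* : ℕ → Term → Abs
λ* x t with occurs? x t
λ* x t         | no _ = κ t
λ* x (var _)   | yes _ = ι
λ* x (con _)   | yes ()
λ* x (u · v)   | yes _ = ς (λ* x u) (λ* x v)

λ*-fresh : ∀ {x t} → ¬ Occurs x t → λ* x t ≡ κ t
λ*-fresh {x} {t} x∉ with occurs? x t
... | no _ = refl
... | yes p = contradiction p x∉

λ*≢K₀ : ∀ x t → ⌜ λ* x t ⌝ ₀ ≢ con K₀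
λ*≢K₀ x t with occurs? x t
λ*≢K₀ x t       | no _ = λ ()
λ*≢K₀ x (var _) | yes _ = λ ()
λ*≢K₀ x (u · v) | yes _ = λ ()

λ*-var : ∀ x → λ* x (var x) ≡ ι
λ*-var x with occurs? x (var x)
... | yes _ = refl
... | no x∉ = contradiction occ-here x∉

Lam-λ* : ∀ x t → Lam ₀ x t (⌜ λ* x t ⌝ ₀)
Lam-λ* x t with occurs? x t
Lam-λ* x t       | no x∉ = Abs⇒Lam ₀ (κ t) x∉
Lam-λ* x (var _) | yes occ-here = lam-I
Lam-λ* x (u · v) | yes _ = lam-S (Lam-λ* x u) (Lam-λ* x v)

▷*-app : ∀ {u u′ v v′} → u ▷* u′ → v ▷* v′ → u · v ▷* u′ · v′
▷*-app p q = gmap (_· _) red-appl p ◅◅ gmap (_ ·_) red-appr q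

-- An element of λ₀ x. t may use `S₂` where `K₀` was possible; `red-SK` repairs this from the leaves
-- upward.
Lam-▷*-λ* : ∀ {x t t′} → Lam ₀ x t t′ → t′ ▷* ⌜ λ* x t ⌝ ₀
Lam-▷*-λ* {x} lam-I rewrite λ*-var x = ε
Lam-▷*-λ* {x} (lam-Kvar {y} y≢x)
  rewrite λ*-fresh {x} {var y} (λ { occ-here → y≢x refl }) = ε
Lam-▷*-λ* {x} (lam-Kcon {c}) rewrite λ*-fresh {x} {con c} (λ ()) = ε
Lam-▷*-λ* (lam-Kapp x∉) rewrite λ*-fresh x∉ = ε
Lam-▷*-λ* {x} (lam-S {u} {v} p q)
  with occurs? x (u · v) | ▷*-app (▷*-app (ε {x = con S₂}) (Lam-▷*-λ* p)) (Lam-▷*-λ* q)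
... | yes _ | steps = steps
... | no x∉ | steps rewrite λ*-fresh (x∉ ∘ occ-l) | λ*-fresh (x∉ ∘ occ-r) =
  steps ◅◅ red-SK ₀ ◅ ε

-- `red-lam` accepts any choice of abstraction on either side, so after the first step every term is
-- abstracted by `λ*`.
ξ-λ* : ∀ {x u v t} → u ▷* v → Lam ₀ x u t → t ▷* ⌜ λ* x v ⌝ ₀
ξ-λ* ε p = Lam-▷*-λ* p
ξ-λ* {x} (_◅_ {j = w} s ss) p = red-lam ₀ x s p (Lam-λ* x w) ◅ ξ-λ* ss (Lam-λ* x w)

infix 4 _⇓□_
data _⇓□_ : Term → Abs → Set where
  step□ : ∀ {t t′ A} → t ⟶ t′ → t′ ⇓□ A → t ⇓□ A
  K□    : ∀ {u} → con K₀ · u ⇓□ κ u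
  I□    : con I₀ ⇓□ ι
  S□    : ∀ {a b A B} → a ⇓□ A → b ⇓□ B → con S₂ · a · b ⇓□ ς A B

-- K₀ is left out because K₀ · s is a λ₀-abstraction.
data Stuck : Term → Set where
  stuck-var : ∀ {x} → Stuck (var x)
  stuck-S₀  : Stuck (con S₀)
  stuck-I₀  : Stuck (con I₀)
  stuck-K   : ∀ {u} → Stuck (con K₀ · u)
  stuck-S   : ∀ {u v} → Stuck (con S₂ · u · v)
  stuck-app : ∀ {t s} → Stuck t → Stuck (t · s)

infix 4 _⇓⟨_⟩_
data _⇓⟨_⟩_ : Term → ℕ → Term → Set where
  step   : ∀ {k t t′ n} → t ⟶ t′ → t′ ⇓⟨ k ⟩ n → t ⇓⟨ k ⟩ n
  ⇓var   : ∀ {k x} → var x ⇓⟨ k ⟩ var x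
  ⇓S₀    : ∀ {k} → con S₀ ⇓⟨ k ⟩ con S₀
  ⇓K₀    : ∀ {k} → con K₀ ⇓⟨ k ⟩ con K₀
  ⇓I₀    : ∀ {k} → con I₀ ⇓⟨ k ⟩ con I₀
  ⇓stuck : ∀ {k t s n m} → Stuck t → t ⇓⟨ k ⟩ n → s ⇓⟨ k ⟩ m → t · s ⇓⟨ k ⟩ n · m
  -- Since `κ u [ var k ]` is `u`, opening `K₀ · u` changes only the level.
  ⇓K     : ∀ {k u n} → u ⇓⟨ suc k ⟩ n → con K₀ · u ⇓⟨ k ⟩ ⌜ λ* k n ⌝ ₀
  ⇓S     : ∀ {k a b A B n} → a ⇓□ A → b ⇓□ B → ς A B [ var k ] ⇓⟨ suc k ⟩ n →
           con S₂ · a · b ⇓⟨ k ⟩ ⌜ λ* k n ⌝ ₀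

⇓□-deterministic : ∀ {t A B} → t ⇓□ A → t ⇓□ B → A ≡ B
⇓□-deterministic (step□ p q) (step□ p′ q′) with ⟶-deterministic p p′
... | refl = ⇓□-deterministic q q′
⇓□-deterministic (step□ (head ()) _) K□
⇓□-deterministic (step□ (head (head ())) _) (S□ _ _)
⇓□-deterministic K□ (step□ (head ()) _)
⇓□-deterministic K□ K□ = refl
⇓□-deterministic I□ I□ = refl
⇓□-deterministic (S□ _ _) (step□ (head (head ())) _)
⇓□-deterministic (S□ p q) (S□ p′ q′) = cong₂ ς (⇓□-deterministic p p′) (⇓□-deterministic q q′)

stuck-irreducible : ∀ {t t′} → Stuck t → ¬ (t ⟶ t′)
stuck-irreducible stuck-K (head ())
stuck-irreducible stuck-S (head (head ()))
stuck-irreducible (stuck-app (stuck-app (stuck-app ()))) S₁-step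
stuck-irreducible (stuck-app (stuck-app (stuck-app ()))) S₃-step
stuck-irreducible (stuck-app p) (head q) = stuck-irreducible p q

⇓-deterministic : ∀ {k t n m} → t ⇓⟨ k ⟩ n → t ⇓⟨ k ⟩ m → n ≡ m
⇓-deterministic (step p q) (step p′ q′) with ⟶-deterministic p p′
... | refl = ⇓-deterministic q q′
⇓-deterministic (step p _) (⇓stuck s _ _) = ⊥-elim (stuck-irreducible (stuck-app s) p)
⇓-deterministic (step (head ()) _) (⇓K _)
⇓-deterministic (step (head (head ())) _) (⇓S _ _ _)
⇓-deterministic ⇓var ⇓var = refl
⇓-deterministic ⇓S₀ ⇓S₀ = refl
⇓-deterministic ⇓K₀ ⇓K₀ = refl
⇓-deterministic ⇓I₀ ⇓I₀ = refl
⇓-deterministic (⇓stuck s _ _) (step p _) = ⊥-elim (stuck-irreducible (stuck-app s) p)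
⇓-deterministic (⇓stuck _ p q) (⇓stuck _ p′ q′) =
  cong₂ _·_ (⇓-deterministic p p′) (⇓-deterministic q q′)
⇓-deterministic (⇓stuck () _ _) (⇓K _)
⇓-deterministic (⇓stuck (stuck-app ()) _ _) (⇓S _ _ _)
⇓-deterministic (⇓K _) (step (head ()) _)
⇓-deterministic (⇓K _) (⇓stuck () _ _)
⇓-deterministic (⇓K p) (⇓K q) = cong (λ n → ⌜ λ* _ n ⌝ ₀) (⇓-deterministic p q)
⇓-deterministic (⇓S _ _ _) (step (head (head ())) _)
⇓-deterministic (⇓S _ _ _) (⇓stuck (stuck-app ()) _ _)
⇓-deterministic (⇓S a b p) (⇓S a′ b′ q)
  with ⇓□-deterministic a a′ | ⇓□-deterministic b b′
... | refl | refl = cong (λ n → ⌜ λ* _ n ⌝ ₀) (⇓-deterministic p q)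

⇓□⇒⇓ : ∀ {k t A n} → t ⇓□ A → A [ var k ] ⇓⟨ suc k ⟩ n → t ⇓⟨ k ⟩ ⌜ λ* k n ⌝ ₀
⇓□⇒⇓ (step□ p q) e = step p (⇓□⇒⇓ q e)
⇓□⇒⇓ K□ e = ⇓K e
⇓□⇒⇓ {k} I□ ⇓var rewrite λ*-var k = ⇓I₀
⇓□⇒⇓ (S□ p q) e = ⇓S p q e

-- The value tells where head reduction of `t` stops: at `K₀` if the value is `K₀`, at a stuck term
-- otherwise. A stuck head leaves the level of the argument unchanged; `⇓-appK` treats the other
-- case.
⇓-app : ∀ {k t n} → t ⇓⟨ k ⟩ n → n ≢ con K₀ →
        ∀ {s m} → s ⇓⟨ k ⟩ m → t · s ⇓⟨ k ⟩ n · m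
⇓-app (step p q) n≢K₀ e = step (head p) (⇓-app q n≢K₀ e)
⇓-app ⇓var n≢K₀ e = ⇓stuck stuck-var ⇓var e
⇓-app ⇓S₀ n≢K₀ e = ⇓stuck stuck-S₀ ⇓S₀ e
⇓-app ⇓K₀ n≢K₀ e = contradiction refl n≢K₀
⇓-app ⇓I₀ n≢K₀ e = ⇓stuck stuck-I₀ ⇓I₀ e
⇓-app (⇓stuck s p q) n≢K₀ e = ⇓stuck (stuck-app s) (⇓stuck s p q) e
⇓-app (⇓K p) n≢K₀ e = ⇓stuck stuck-K (⇓K p) e
⇓-app (⇓S a b p) n≢K₀ e = ⇓stuck stuck-S (⇓S a b p) e

⇓-appK : ∀ {k t n} → t ⇓⟨ k ⟩ n → n ≡ con K₀ →
         ∀ {s m} → s ⇓⟨ suc k ⟩ m → t · s ⇓⟨ k ⟩ ⌜ λ* k m ⌝ ₀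
⇓-appK (step p q) n≡K₀ e = step (head p) (⇓-appK q n≡K₀ e)
⇓-appK ⇓K₀ n≡K₀ e = ⇓K e
⇓-appK (⇓K {k} {n = n} _) n≡K₀ e = contradiction n≡K₀ (λ*≢K₀ k n)
⇓-appK (⇓S {k} {n = n} _ _ _) n≡K₀ e = contradiction n≡K₀ (λ*≢K₀ k n)

K₀? : ∀ t → Dec (t ≡ con K₀)
K₀? (var _) = no λ ()
K₀? (con S₀) = no λ ()
K₀? (con S₁) = no λ ()
K₀? (con S₂) = no λ ()
K₀? (con S₃) = no λ ()
K₀? (con K₀) = yes refl
K₀? (con K₁) = no λ ()
K₀? (con I₀) = no λ ()
K₀? (con I₁) = no λ ()
K₀? (_ · _) = no λ ()

-- Evaluation at a level above all variables is reduction

Below : ℕ → Term → Set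
Below k (var x) = x < k
Below k (con _) = ⊤
Below k (u · v) = Below k u × Below k v

BelowA : ℕ → Abs → Set
BelowA k (κ u) = Below k u
BelowA k ι = ⊤
BelowA k (ς A B) = BelowA k A × BelowA k B

Below-mono : ∀ {j k} → j ≤ k → ∀ t → Below j t → Below k t
Below-mono j≤k (var x) b = ≤-trans b j≤k
Below-mono j≤k (con _) b = tt
Below-mono j≤k (u · v) (b , c) = Below-mono j≤k u b , Below-mono j≤k v c

bound : Term → ℕ
bound (var x) = suc x
bound (con _) = zero
bound (u · v) = bound u ⊔ bound v

Below-bound : ∀ t → Below (bound t) t
Below-bound (var x) = n<1+n x
Below-bound (con _) = tt
Below-bound (u · v) = Below-mono (m≤m⊔n _ _) u (Below-bound u)
                    , Below-mono (m≤n⊔m (bound u) _) v (Below-bound v)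

Below⇒fresh : ∀ {k t} → Below k t → ¬ Occurs k t
Below⇒fresh b occ-here = <-irrefl refl b
Below⇒fresh (b , _) (occ-l p) = Below⇒fresh b p
Below⇒fresh (_ , b) (occ-r p) = Below⇒fresh b p

BelowA⇒FreshA : ∀ {k} A → BelowA k A → FreshA k A
BelowA⇒FreshA (κ u) b = Below⇒fresh b
BelowA⇒FreshA ι b = tt
BelowA⇒FreshA (ς A B) (b , c) = BelowA⇒FreshA A b , BelowA⇒FreshA B c

Below-inst : ∀ {k} A → BelowA k A → Below (suc k) (A [ var k ])
Below-inst (κ u) b = Below-mono (n≤1+n _) u b
Below-inst ι b = n<1+n _
Below-inst (ς A B) (b , c) = Below-inst A b , Below-inst B c

Below-strengthen : ∀ {k} t → Below (suc k) t → ¬ Occurs k t → Below k t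
Below-strengthen (var x) b k∉ = ≤∧≢⇒< (≤-pred b) λ { refl → k∉ occ-here }
Below-strengthen (con _) b k∉ = tt
Below-strengthen (u · v) (b , c) k∉ =
  Below-strengthen u b (k∉ ∘ occ-l) , Below-strengthen v c (k∉ ∘ occ-r)

Below-λ* : ∀ {k} t → Below (suc k) t → Below k (⌜ λ* k t ⌝ ₀)
Below-λ* {k} t b with occurs? k t
Below-λ* t b             | no k∉ = tt , Below-strengthen t b k∉
Below-λ* (var _) b       | yes _ = tt
Below-λ* (u · v) (b , c) | yes _ = (tt , Below-λ* u b) , Below-λ* v c

Below-⟶ : ∀ {k t t′} → t ⟶ t′ → Below k t → Below k t′
Below-⟶ S₁-step (((_ , bu) , bv) , bw) = (bu , bw) , (bv , bw)
Below-⟶ S₃-step (((_ , bu) , bv) , bw) = (bu , bw) , (bv , bw)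
Below-⟶ K₁-step ((_ , bu) , _) = bu
Below-⟶ I₁-step (_ , bu) = bu
Below-⟶ (head p) (bu , bv) = Below-⟶ p bu , bv

⇓□-sound : ∀ {k t A} → t ⇓□ A → Below k t → t ▷* ⌜ A ⌝ ₀ × BelowA k A
⇓□-sound (step□ p q) b with ⇓□-sound q (Below-⟶ p b)
... | steps , bA = ⟶⇒▷ p ◅ steps , bA
⇓□-sound K□ (_ , b) = ε , b
⇓□-sound I□ b = ε , tt
⇓□-sound (S□ p q) ((_ , ba) , bb) with ⇓□-sound p ba | ⇓□-sound q bb
... | ps , bA | qs , bB = ▷*-app (▷*-app ε ps) qs , (bA , bB)

⇓-sound : ∀ {k t n} → t ⇓⟨ k ⟩ n → Below k t → t ▷* n × Below k n

-- The bound makes `k` fresh for `A`, so `⌜ A ⌝ ₀` is a λ₀-abstraction of the opened term and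
-- reductions of that term lift to it. Closing removes `k` and restores the bound.
ξ-sound : ∀ {k n} A → A [ var k ] ⇓⟨ suc k ⟩ n → BelowA k A →
          ⌜ A ⌝ ₀ ▷* ⌜ λ* k n ⌝ ₀ × Below k (⌜ λ* k n ⌝ ₀)
ξ-sound A e b with ⇓-sound e (Below-inst A b)
... | steps , bn = ξ-λ* steps (Abs⇒Lam ₀ A (BelowA⇒FreshA A b)) , Below-λ* _ bn

⇓-sound (step p q) b with ⇓-sound q (Below-⟶ p b)
... | steps , bn = ⟶⇒▷ p ◅ steps , bn
⇓-sound ⇓var b = ε , b
⇓-sound ⇓S₀ b = ε , b
⇓-sound ⇓K₀ b = ε , b
⇓-sound ⇓I₀ b = ε , b
⇓-sound (⇓stuck _ p q) (b , c) with ⇓-sound p b | ⇓-sound q c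
... | ps , bn | qs , bm = ▷*-app ps qs , (bn , bm)
⇓-sound (⇓K {u = u} e) (_ , b) = ξ-sound (κ u) e b
⇓-sound (⇓S {A = A} {B} p q e) b with ⇓□-sound (S□ p q) b
... | steps , bAB with ξ-sound (ς A B) e bAB
... | steps′ , bn = steps ◅◅ steps′ , bn

-- Reducibility

-- Asking for a common value at every level makes □o⇒o, which passes from k to suc k, free of
-- renaming arguments.
R : Ty → Term → Term → Set
R o t t′ = ∀ k → ∃ λ n → t ⇓⟨ k ⟩ n × t′ ⇓⟨ k ⟩ n
R (σ ⇒ τ) t t′ = ∀ {s s′} → R σ s s′ → R τ (t · s) (t′ · s′)
R (□ τ) t t′ = ∃ λ A → ∃ λ A′ → t ⇓□ A × t′ ⇓□ A′ ×
  (∀ {s s′} → R o s s′ → R τ (A [ s ]) (A′ [ s′ ]))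

Ro-sym : ∀ {t t′} → R o t t′ → R o t′ t
Ro-sym p k with p k
... | n , e , e′ = n , e′ , e

-- Determinism gives the middle term a single value at each level.
Ro-trans : ∀ {t t′ t″} → R o t t′ → R o t′ t″ → R o t t″
Ro-trans p q k with p k | q k
... | n , e , e₁ | m , e₂ , e′ = n , e , subst (_ ⇓⟨ k ⟩_) (⇓-deterministic e₂ e₁) e′

R-sym : ∀ τ {t t′} → R τ t t′ → R τ t′ t
R-sym o = Ro-sym
R-sym (σ ⇒ τ) p q = R-sym τ (p (R-sym σ q))
R-sym (□ τ) (A , A′ , e , e′ , p) = A′ , A , e′ , e , λ q → R-sym τ (p (Ro-sym q))

R-trans : ∀ τ {t t′ t″} → R τ t t′ → R τ t′ t″ → R τ t t″
R-trans o = Ro-trans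
-- Symmetry and transitivity at `σ` relate the right-hand argument to itself.
R-trans (σ ⇒ τ) p q s = R-trans τ (p s) (q (R-trans σ (R-sym σ s) s))
R-trans (□ τ) (A , A₁ , e , e₁ , p) (A₂ , A′ , e₂ , e′ , q) with ⇓□-deterministic e₁ e₂
... | refl = A , A′ , e , e′ , λ s → R-trans τ (p s) (q (Ro-trans (Ro-sym s) s))

-- At `o` and `□ τ` a head step may be put before the evaluation; at function types it passes under
-- the application.
R-expandˡ : ∀ τ {t t₁ t′} → t ⟶ t₁ → R τ t₁ t′ → R τ t t′
R-expandˡ o p q k with q k
... | n , e , e′ = n , step p e , e′
R-expandˡ (σ ⇒ τ) p q s = R-expandˡ τ (head p) (q s)
R-expandˡ (□ τ) p (A , A′ , e , e′ , q) = A , A′ , step□ p e , e′ , q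

R-expand : ∀ τ {t t₁ t′ t₁′} → t ⟶ t₁ → t′ ⟶ t₁′ → R τ t₁ t₁′ → R τ t t′
R-expand τ p p′ q = R-expandˡ τ p (R-sym τ (R-expandˡ τ p′ (R-sym τ q)))

R-app : ∀ {ρ σ τ t t′ s s′} → Ap ρ σ τ → R ρ t t′ → R σ s s′ → R τ (t · s) (t′ · s′)
R-app fun p q = p q
R-app inert p q k with p k
-- Both heads share the value `n`, so one case distinction selects the same rule on both sides. If
-- `n` is `K₀`, the argument stands under a λ₀ and is compared at the next level.
... | n , e , e′ with K₀? n
...   | yes n≡K₀ with q (suc k)
...     | m , f , f′ = ⌜ λ* k m ⌝ ₀ , ⇓-appK e n≡K₀ f , ⇓-appK e′ n≡K₀ f′
R-app inert p q k | n , e , e′ | no n≢K₀ with q k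
...     | m , f , f′ = n · m , ⇓-app e n≢K₀ f , ⇓-app e′ n≢K₀ f′

R-var : ∀ x → R o (var x) (var x)
R-var x k = var x , ⇓var , ⇓var

-- The instances at `var k` have a common value at level `suc k`, which `λ*` closes to a common
-- value at `k`.
□o⇒o : ∀ {t t′} → R (□ o) t t′ → R o t t′
□o⇒o (A , A′ , e , e′ , p) k with p (R-var k) (suc k)
... | n , f , f′ = ⌜ λ* k n ⌝ ₀ , ⇓□⇒⇓ e f , ⇓□⇒⇓ e′ f′

R-S□ : ∀ {ρ σ τ} → Ap ρ σ τ → R (□ ρ ⇒ □ σ ⇒ □ τ) (con S₂) (con S₂)
R-S□ ap (A , A′ , e , e′ , p) (B , B′ , f , f′ , q) =
  ς A B , ς A′ B′ , S□ e f , S□ e′ f′ , λ s → R-app ap (p s) (q s)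

-- Substitution

Subst : Set
Subst = ℕ → Term

_⟪_⟫ : Term → Subst → Term
var x ⟪ γ ⟫ = γ x
con c ⟪ γ ⟫ = con c
(u · v) ⟪ γ ⟫ = u ⟪ γ ⟫ · v ⟪ γ ⟫

_⟪_⟫ᵃ : Abs → Subst → Abs
κ u ⟪ γ ⟫ᵃ = κ (u ⟪ γ ⟫)
ι ⟪ γ ⟫ᵃ = ι
ς A B ⟪ γ ⟫ᵃ = ς (A ⟪ γ ⟫ᵃ) (B ⟪ γ ⟫ᵃ)

⟪var⟫ : ∀ t → t ⟪ var ⟫ ≡ t
⟪var⟫ (var x) = refl
⟪var⟫ (con c) = refl
⟪var⟫ (u · v) = cong₂ _·_ (⟪var⟫ u) (⟪var⟫ v)

_[_↦_] : Subst → ℕ → Term → Subst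
(γ [ x ↦ s ]) y with y ≟ x
... | yes _ = s
... | no _ = γ y

↦-same : ∀ γ x s → (γ [ x ↦ s ]) x ≡ s
↦-same γ x s with x ≟ x
... | yes _ = refl
... | no x≢x = contradiction refl x≢x

⟪↦⟫-fresh : ∀ {γ x s} t → ¬ Occurs x t → t ⟪ γ [ x ↦ s ] ⟫ ≡ t ⟪ γ ⟫
⟪↦⟫-fresh {x = x} (var y) x∉ with y ≟ x
... | yes refl = contradiction occ-here x∉
... | no _ = refl
⟪↦⟫-fresh (con c) x∉ = refl
⟪↦⟫-fresh (u · v) x∉ = cong₂ _·_ (⟪↦⟫-fresh u (x∉ ∘ occ-l)) (⟪↦⟫-fresh v (x∉ ∘ occ-r))

-- Freshness confines the effect of the updated entry to the `ι` leaves.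
⟪↦⟫-inst : ∀ {γ x s} A → FreshA x A → A [ var x ] ⟪ γ [ x ↦ s ] ⟫ ≡ A ⟪ γ ⟫ᵃ [ s ]
⟪↦⟫-inst (κ u) x∉ = ⟪↦⟫-fresh u x∉
⟪↦⟫-inst {γ} {x} {s} ι x∉ = ↦-same γ x s
⟪↦⟫-inst (ς A B) (x∉A , x∉B) = cong₂ _·_ (⟪↦⟫-inst A x∉A) (⟪↦⟫-inst B x∉B)

⟪⟫-⌜⌝ : ∀ {γ} i A → ⌜ A ⌝ i ⟪ γ ⟫ ≡ ⌜ A ⟪ γ ⟫ᵃ ⌝ i
⟪⟫-⌜⌝ ₀ (κ u) = refl
⟪⟫-⌜⌝ ₁ (κ u) = refl
⟪⟫-⌜⌝ ₀ ι = refl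
⟪⟫-⌜⌝ ₁ ι = refl
⟪⟫-⌜⌝ ₀ (ς A B) = cong₂ (λ a b → con S₂ · a · b) (⟪⟫-⌜⌝ ₀ A) (⟪⟫-⌜⌝ ₀ B)
⟪⟫-⌜⌝ ₁ (ς A B) = cong₂ (λ a b → con S₃ · a · b) (⟪⟫-⌜⌝ ₁ A) (⟪⟫-⌜⌝ ₁ B)

⟪⟫-⟶ : ∀ {γ t t′} → t ⟶ t′ → t ⟪ γ ⟫ ⟶ t′ ⟪ γ ⟫
⟪⟫-⟶ S₁-step = S₁-step
⟪⟫-⟶ S₃-step = S₃-step
⟪⟫-⟶ K₁-step = K₁-step
⟪⟫-⟶ I₁-step = I₁-step
⟪⟫-⟶ (head p) = head (⟪⟫-⟶ p)

-- Related substitutions and the fundamental lemma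

RS : Subst → Subst → Set
RS γ γ′ = ∀ x → R o (γ x) (γ′ x)

RS-↦ : ∀ {γ γ′ s s′} x → RS γ γ′ → R o s s′ → RS (γ [ x ↦ s ]) (γ′ [ x ↦ s′ ])
RS-↦ x g p y with y ≟ x
... | yes _ = p
... | no _ = g y

RS-reflˡ : ∀ {γ γ′} → RS γ γ′ → RS γ γ
RS-reflˡ g x = Ro-trans (g x) (Ro-sym (g x))

RS-reflʳ : ∀ {γ γ′} → RS γ γ′ → RS γ′ γ′
RS-reflʳ g x = Ro-trans (Ro-sym (g x)) (g x)

-- The level-1 combinators follow by head expansion; `S₂` at its type ending in `o` is its `□`
-- typing followed by `□o⇒o`.
⊢⇒R : ∀ {t τ γ γ′} → t ∶ τ → RS γ γ′ → R τ (t ⟪ γ ⟫) (t ⟪ γ′ ⟫)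
⊢⇒R (⊢var {x}) g = g x
⊢⇒R ⊢S₀ g k = con S₀ , ⇓S₀ , ⇓S₀
⊢⇒R ⊢K₀ g k = con K₀ , ⇓K₀ , ⇓K₀
⊢⇒R ⊢I₀ g k = con I₀ , ⇓I₀ , ⇓I₀
⊢⇒R ⊢K□ g p = _ , _ , K□ , K□ , λ _ → p
⊢⇒R ⊢I□ g = ι , ι , I□ , I□ , λ p → p
⊢⇒R (⊢S□ ap) g = R-S□ ap
⊢⇒R (⊢S₂ ap) g p q = □o⇒o (R-S□ ap p q)
⊢⇒R (⊢K₁ {τ}) g p _ = R-expand τ K₁-step K₁-step p
⊢⇒R ⊢I₁ g = R-expand o I₁-step I₁-step
⊢⇒R ⊢S₁ g p q s =
  R-expand o S₁-step S₁-step (R-app inert (R-app inert p s) (R-app inert q s))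
⊢⇒R (⊢S₃ {τ = τ} ap) g p q s = R-expand τ S₃-step S₃-step (R-app ap (p s) (q s))
⊢⇒R (⊢app ap ⊢u ⊢v) g = R-app ap (⊢⇒R ⊢u g) (⊢⇒R ⊢v g)

-- Invariance under reduction, and confluence

⌜⌝⇓□ : ∀ A → ⌜ A ⌝ ₀ ⇓□ A
⌜⌝⇓□ (κ u) = K□
⌜⌝⇓□ ι = I□
⌜⌝⇓□ (ς A B) = S□ (⌜⌝⇓□ A) (⌜⌝⇓□ B)

-- Only the left side is head-expanded, so an applied λ₁-abstraction is compared with its instance.
R-β : ∀ {A τ γ s s′} → A ∶ᵇ τ → RS γ γ → R o s s′ →
      R τ (⌜ A ⟪ γ ⟫ᵃ ⌝ ₁ · s) (A ⟪ γ ⟫ᵃ [ s′ ])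
R-β {τ = τ} (⊢κ ⊢u) g p = R-expandˡ τ K₁-step (⊢⇒R ⊢u g)
R-β ⊢ι g p = R-expandˡ o I₁-step p
R-β {τ = τ} (⊢ς ap ⊢A ⊢B) g p = R-expandˡ τ S₃-step (R-app ap (R-β ⊢A g p) (R-β ⊢B g p))

-- The common core of `red-SK` and `red-lam`. At level `₀` related instances are what `R` demands at
-- `□` types; at level `₁` both applied abstractions are first exchanged for their instances by
-- `R-β`.
R-ξ : ∀ i {A B τ γ γ′} → AbsTy i A τ → (∀ {τ} → A ∶ᵇ τ → B ∶ᵇ τ) → RS γ γ′ →
      (∀ {τ s s′} → A ∶ᵇ τ → R o s s′ → R τ (A ⟪ γ ⟫ᵃ [ s ]) (B ⟪ γ′ ⟫ᵃ [ s′ ])) →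
      R τ (⌜ A ⌝ i ⟪ γ ⟫) (⌜ B ⌝ i ⟪ γ′ ⟫)
R-ξ i {A} {B} {τ} {γ} {γ′} ⊢A A⇒B g p =
  subst₂ (R τ) (sym (⟪⟫-⌜⌝ i A)) (sym (⟪⟫-⌜⌝ i B)) (go i ⊢A)
  where
  A′ = A ⟪ γ ⟫ᵃ
  B′ = B ⟪ γ′ ⟫ᵃ
  go : ∀ i {τ} → AbsTy i A τ → R τ (⌜ A′ ⌝ i) (⌜ B′ ⌝ i)
  go ₀ (arrow ⊢A) = A′ , B′ , ⌜⌝⇓□ A′ , ⌜⌝⇓□ B′ , p ⊢A
  go ₀ (base ⊢A) = □o⇒o (A′ , B′ , ⌜⌝⇓□ A′ , ⌜⌝⇓□ B′ , p ⊢A)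
  go ₁ (arrow {τ = τ} ⊢A) s =
    R-trans τ (R-β ⊢A (RS-reflˡ g) (Ro-trans s (Ro-sym s)))
      (R-trans τ (p ⊢A s)
        (R-sym τ (R-β (A⇒B ⊢A) (RS-reflʳ g) (Ro-trans (Ro-sym s) s))))

⟶⇒R : ∀ {t t′ τ γ γ′} → t ⟶ t′ → t ∶ τ → RS γ γ′ → R τ (t ⟪ γ ⟫) (t′ ⟪ γ′ ⟫)
⟶⇒R {τ = τ} p ⊢t g = R-expandˡ τ (⟪⟫-⟶ p) (⊢⇒R (⊢-⟶ p ⊢t) g)

▷⇒R : ∀ {t t′ τ γ γ′} → t ▷ t′ → t ∶ τ → RS γ γ′ → R τ (t ⟪ γ ⟫) (t′ ⟪ γ′ ⟫)
▷⇒R red-S₁ = ⟶⇒R S₁-step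
▷⇒R red-S₃ = ⟶⇒R S₃-step
▷⇒R red-K₁ = ⟶⇒R K₁-step
▷⇒R red-I₁ = ⟶⇒R I₁-step
▷⇒R (red-SK i {u} {v}) ⊢t g =
  R-ξ i {ς (κ u) (κ v)} {κ (u · v)} (⊢⇒AbsTy i _ ⊢t) ⊢SK g
    λ { (⊢ς ap (⊢κ ⊢u) (⊢κ ⊢v)) _ → ⊢⇒R (⊢app ap ⊢u ⊢v) g }
▷⇒R (red-lam i x p lu lv) ⊢t g with Lam⇒Abstracts lu | Lam⇒Abstracts lv
... | abstracts A x∉A | abstracts B x∉B =
  R-ξ i (⊢⇒AbsTy i A ⊢t) (λ ⊢A → ⊢uninst B (⊢-▷ p (⊢inst ⊢A ⊢var))) g
    -- The induction hypothesis is used with `x` sent to an arbitrary related pair, which is why the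
    -- statement ranges over related substitutions.
    λ {τ} ⊢A s → subst₂ (R τ) (⟪↦⟫-inst A x∉A) (⟪↦⟫-inst B x∉B)
      (▷⇒R p (⊢inst ⊢A ⊢var) (RS-↦ x g s))
▷⇒R (red-appl p) (⊢app ap ⊢u ⊢v) g = R-app ap (▷⇒R p ⊢u g) (⊢⇒R ⊢v g)
▷⇒R (red-appr p) (⊢app ap ⊢u ⊢v) g = R-app ap (⊢⇒R ⊢u g) (▷⇒R p ⊢v g)

▷*⇒R : ∀ {t t′} → t ▷* t′ → t ∶ o → R o t t′
▷*⇒R {t} ε ⊢t = subst₂ (R o) (⟪var⟫ t) (⟪var⟫ t) (⊢⇒R ⊢t R-var)
▷*⇒R {t} (_◅_ {j = t₁} p ps) ⊢t =
  Ro-trans (subst₂ (R o) (⟪var⟫ t) (⟪var⟫ t₁) (▷⇒R p ⊢t R-var)) (▷*⇒R ps (⊢-▷ p ⊢t))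

theorem5 : (t t₁ t₂ : Term) → Fair t → t ▷* t₁ → t ▷* t₂ →
    Σ Term (λ t₃ → (t₁ ▷* t₃) × (t₂ ▷* t₃))
theorem5 t t₁ t₂ fair p q
  -- This level exceeds all variables of `t₁` and `t₂`, so evaluation there is reduction and the
  -- common value is a common reduct.
  with Ro-trans (Ro-sym (▷*⇒R p (⊢Fair fair))) (▷*⇒R q (⊢Fair fair)) (bound t₁ ⊔ bound t₂)
... | n , e₁ , e₂ =
  n , proj₁ (⇓-sound e₁ (Below-mono (m≤m⊔n _ _) t₁ (Below-bound t₁)))
    , proj₁ (⇓-sound e₂ (Below-mono (m≤n⊔m (bound t₁) _) t₂ (Below-bound t₂)))
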